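{- On the class $\mathsf{Cycles}$ of finite disjoint unions of (undirected) cycles, the orders $(\mathsf{Cycles},\leq^{LB})$, $(\mathsf{Cycles},\leq^{LS})$ and $(\mathsf{Cycles},\leq^{LI})$ coincide, and this order is universal.
   Context: $C_k$ ($k\geq3$) is the undirected cycle with $k$ vertices; $\mathsf{Cycles}$ is the class of graphs that are disjoint unions of finitely many cycles $C_k$, $k\ge 3$. $N_G(v)$ is the set of vertices adjacent to $v$. A graph homomorphism $f:G\to H$ is locally injective (LI), locally surjective (LS), or locally bijective (LB) if for every $v\in V_G$ the restriction of $f$ to $N_G(v)\to N_H(f(v))$ is injective, surjective, or bijective, respectively. $G\leq^{LI}H$, $G\leq^{LS}H$, $G\leq^{LB}H$ denote the existence of such a homomorphism from $G$ to $H$. These quasi-orders are regarded as partial orders by identifying equivalent graphs ($G\leq H\leq G$). A countable partial order is universal if every countable partial order $(P,\leq_P)$ embeds into it, i.e. there is a map $E$ with $a\leq_P b\iff E(a)\leq E(b)$ for all $a,b\in P$. -}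

module Defs where

open import Data.Fin.Base using (Fin; toℕ)
open import Data.Fin.Properties using (toℕ<n)
open import Data.Nat.Base using (ℕ; suc; _≤_; _%_; NonZero; >-nonZero; z≤n; s≤s)
open import Data.Nat.DivMod using (m<n⇒m%n≡m; n%n≡0)
open import Data.Nat.Properties using (≤-trans; m≤n⇒m<n∨m≡n; 1+n≢n)
open import Data.Product.Base using (Σ-syntax; ∃-syntax; _×_; _,_; proj₁)
open import Data.Sum.Base using (_⊎_; inj₁; inj₂; swap; [_,_]′)
open import Function.Base using (_∘_; _on_; id)
open import Function.Bundles using (_↔_; _⇔_; Injection; module Inverse)
import Function.Construct.Composition as Composition
import Function.Construct.Identity as Identity
open import Function.Definitions using (Injective; Surjective; Bijective)
open import Level using (Level; _⊔_) renaming (zero to 0ℓ; suc to lsuc)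
open import Relation.Binary.Bundles using (Poset)
import Relation.Binary.Construct.Interior.Symmetric as SymInterior
open import Relation.Binary.Core using (Rel)
open import Relation.Binary.Definitions using (Reflexive; Transitive)
open import Relation.Binary.PropositionalEquality using (_≡_; refl; sym; trans; cong; setoid)
open import Relation.Nullary.Negation using (¬_)

record Graph : Set₁ where
  field
    V         : Set
    Adj       : Rel V 0ℓ
    symmetric : ∀ {u v} → Adj u v → Adj v u
    loopless  : ∀ {v} → ¬ Adj v v

open Graph public using (V; Adj)

N : (G : Graph) → V G → Set
N G v = Σ[ u ∈ V G ] Adj G v u

-- Neighbours are compared as vertices: the proof of adjacency is ignored, so
-- that N G v behaves as a subset of V G.
SameVertex : (G : Graph) (v : V G) → Rel (N G v) 0ℓ
SameVertex G v = _≡_ on proj₁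

record Hom (G H : Graph) : Set where
  constructor hom
  field
    map       : V G → V H
    preserves : ∀ {u v} → Adj G u v → Adj H (map u) (map v)

open Hom public

restrict : {G H : Graph} (f : Hom G H) (v : V G) → N G v → N H (map f v)
restrict f v (u , v~u) = map f u , preserves f v~u

LocallyInjective : {G H : Graph} → Hom G H → Set
LocallyInjective {G} {H} f =
  ∀ v → Injective (SameVertex G v) (SameVertex H (map f v)) (restrict f v)

LocallySurjective : {G H : Graph} → Hom G H → Set
LocallySurjective {G} {H} f =
  ∀ v → Surjective (SameVertex G v) (SameVertex H (map f v)) (restrict f v)

LocallyBijective : {G H : Graph} → Hom G H → Set
LocallyBijective {G} {H} f =
  ∀ v → Bijective (SameVertex G v) (SameVertex H (map f v)) (restrict f v)

infix 4 _≤ᴸᴵ_ _≤ᴸˢ_ _≤ᴸᴮ_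

_≤ᴸᴵ_ : Rel Graph 0ℓ
G ≤ᴸᴵ H = Σ[ f ∈ Hom G H ] LocallyInjective f

_≤ᴸˢ_ : Rel Graph 0ℓ
G ≤ᴸˢ H = Σ[ f ∈ Hom G H ] LocallySurjective f

_≤ᴸᴮ_ : Rel Graph 0ℓ
G ≤ᴸᴮ H = Σ[ f ∈ Hom G H ] LocallyBijective f

idHom : (G : Graph) → Hom G G
idHom G = hom id id

compose : {G H K : Graph} → Hom G H → Hom H K → Hom G K
compose f g = hom (map g ∘ map f) (preserves g ∘ preserves f)

≤ᴸᴵ-refl : Reflexive _≤ᴸᴵ_
≤ᴸᴵ-refl {G} = idHom G , λ _ eq → eq

≤ᴸˢ-refl : Reflexive _≤ᴸˢ_
≤ᴸˢ-refl {G} = idHom G , λ v → Identity.surjective (SameVertex G v)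

≤ᴸᴮ-refl : Reflexive _≤ᴸᴮ_
≤ᴸᴮ-refl {G} = idHom G , λ v → Identity.bijective (SameVertex G v)

≤ᴸᴵ-trans : Transitive _≤ᴸᴵ_
≤ᴸᴵ-trans (f , p) (g , q) = compose f g , λ v {x} {y} →
  p v {x} {y} ∘ q (map f v) {restrict f v x} {restrict f v y}

≤ᴸˢ-trans : Transitive _≤ᴸˢ_
≤ᴸˢ-trans {G} {H} {K} (f , p) (g , q) = compose f g , λ v →
  Composition.surjective (SameVertex G v) (SameVertex H (map f v))
    (SameVertex K (map g (map f v))) {restrict f v} {restrict g (map f v)} (p v) (q (map f v))

≤ᴸᴮ-trans : Transitive _≤ᴸᴮ_
≤ᴸᴮ-trans {G} {H} {K} (f , p) (g , q) = compose f g , λ v →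
  Composition.bijective (SameVertex G v) (SameVertex H (map f v))
    (SameVertex K (map g (map f v))) {restrict f v} {restrict g (map f v)} (p v) (q (map f v))

infix 4 _≅_

_≅_ : Rel Graph 0ℓ
G ≅ H = Σ[ f ∈ V G ↔ V H ]
  (∀ {u v} → Adj G u v ⇔ Adj H (Inverse.to f u) (Inverse.to f v))

3≤⇒nonZero : ∀ {k} → 3 ≤ k → NonZero k
3≤⇒nonZero 3≤k = >-nonZero (≤-trans (s≤s z≤n) 3≤k)

Next : (k : ℕ) → .{{NonZero k}} → Rel (Fin k) 0ℓ
Next k u v = suc (toℕ u) % k ≡ toℕ v

Next-irrefl : ∀ {k} (3≤k : 3 ≤ k) (v : Fin k) → ¬ Next k {{3≤⇒nonZero 3≤k}} v v
Next-irrefl {k} 3≤k v eq with m≤n⇒m<n∨m≡n (toℕ<n v)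
... | inj₁ 1+v<k =
  1+n≢n (trans (sym (m<n⇒m%n≡m {{3≤⇒nonZero 3≤k}} 1+v<k)) eq)
... | inj₂ 1+v≡k = absurd (trans (sym 1+v≡k) (cong suc v≡0)) 3≤k
  where
  instance
    _ : NonZero k
    _ = 3≤⇒nonZero 3≤k

  v≡0 : toℕ v ≡ 0
  v≡0 = trans (sym eq) (trans (cong (_% k) 1+v≡k) (n%n≡0 k))

  absurd : ∀ {j} → j ≡ 1 → ¬ (3 ≤ j)
  absurd refl (s≤s ())

C : (k : ℕ) → 3 ≤ k → Graph
C k 3≤k = record
  { V         = Fin k
  ; Adj       = λ u v → Next k u v ⊎ Next k v u
  ; symmetric = swap
  ; loopless  = λ {v} → [ Next-irrefl 3≤k v , Next-irrefl 3≤k v ]′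
  }
  where
  instance
    _ : NonZero k
    _ = 3≤⇒nonZero 3≤k

module _ {I : Set} (G : I → Graph) where

  data ⨆Adj : Rel (Σ[ i ∈ I ] V (G i)) 0ℓ where
    within : ∀ {i u v} → Adj (G i) u v → ⨆Adj (i , u) (i , v)

  ⨆ : Graph
  ⨆ = record
    { V         = Σ[ i ∈ I ] V (G i)
    ; Adj       = ⨆Adj
    ; symmetric = λ { (within {i} e) → within (Graph.symmetric (G i) e) }
    ; loopless  = λ { (within {i} e) → Graph.loopless (G i) e }
    }

IsDisjointUnionOfCycles : Graph → Set
IsDisjointUnionOfCycles G =
  ∃[ n ] Σ[ k ∈ (Fin n → ℕ) ] Σ[ 3≤k ∈ (∀ i → 3 ≤ k i) ]
    G ≅ ⨆ (λ i → C (k i) (3≤k i))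

record Cycles : Set₁ where
  field
    graph    : Graph
    isCycles : IsDisjointUnionOfCycles graph

open Cycles public

-- The equality of each of these posets is mutual comparability.

Cycles-LI : Poset (lsuc 0ℓ) 0ℓ 0ℓ
Cycles-LI = SymInterior.poset {R = _≤ᴸᴵ_ on graph}
  (λ {G} → ≤ᴸᴵ-refl {graph G}) (λ {G H K} → ≤ᴸᴵ-trans {graph G} {graph H} {graph K})

Cycles-LS : Poset (lsuc 0ℓ) 0ℓ 0ℓ
Cycles-LS = SymInterior.poset {R = _≤ᴸˢ_ on graph}
  (λ {G} → ≤ᴸˢ-refl {graph G}) (λ {G H K} → ≤ᴸˢ-trans {graph G} {graph H} {graph K})

Cycles-LB : Poset (lsuc 0ℓ) 0ℓ 0ℓ
Cycles-LB = SymInterior.poset {R = _≤ᴸᴮ_ on graph}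
  (λ {G} → ≤ᴸᴮ-refl {graph G}) (λ {G H K} → ≤ᴸᴮ-trans {graph G} {graph H} {graph K})

private
  variable
    a b d c ℓ₁ ℓ₂ : Level

Countable : Poset c ℓ₁ ℓ₂ → Set (c ⊔ ℓ₁)
Countable P = Injection (Poset.Eq.setoid P) (setoid ℕ)

-- E respects the equalities of P and Q automatically, by antisymmetry.
EmbedsInto : Poset c ℓ₁ ℓ₂ → Poset a b d → Set (c ⊔ ℓ₂ ⊔ a ⊔ d)
EmbedsInto P Q = Σ[ E ∈ (P.Carrier → Q.Carrier) ] (∀ x y → x P.≤ y ⇔ E x Q.≤ E y)
  where
  module P = Poset P
  module Q = Poset Q

-- The levels c, ℓ₁, ℓ₂ are those of the orders to be embedded.
Universal : (c ℓ₁ ℓ₂ : Level) → Poset a b d → Set (lsuc (c ⊔ ℓ₁ ⊔ ℓ₂) ⊔ a ⊔ b ⊔ d)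
Universal c ℓ₁ ℓ₂ Q =
  Countable Q × ((P : Poset c ℓ₁ ℓ₂) → Countable P → EmbedsInto P Q)

{-# OPTIONS --safe #-}
-- Orient every cycle and let next be the resulting rotation of the vertices. A
-- homomorphism that is locally injective or locally surjective never sends
-- next (next v) and v to the same vertex, so along each cycle it either commutes
-- with next or reverses it; hence a cycle of length k is wound around a cycle whose
-- length divides k. Conversely C k wraps around C m by reduction modulo m whenever
-- m ∣ k. All three orders thus say that every length of G is a multiple of a length of H.
--
-- Only the set of multiples of the lengths of G then matters, and the least number that
-- encodes a finite set of lengths with these multiples is a code for the class of G.
--
-- For universality, a disjoint union of cycles is read as a positive formula over the
-- variables p₀, p₁, …, true at v when v is a multiple of one of its lengths; pᵢ is the
-- cycle whose length is the i-th member of a sequence of distinct primes, disjunction is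
-- union and conjunction takes pairwise lcms. The countable order R, transported to ℕ, is
-- embedded by
--   φₙ = (pₙ ∧ ⋀ {φₘ | m < n, R n m}) ∨ ⋁ {φₘ | m < n, R m n}.
-- It is monotone by construction, and it reflects the order since, when exactly the pᵢ
-- with R z i are true, φₙ is true if and only if R z n.

module Submission where

open import Defs
open import Axiom.ExcludedMiddle using (ExcludedMiddle)
open import Data.Empty using (⊥-elim)
open import Data.Fin.Base using (Fin; toℕ)
open import Data.Fin.Properties using (toℕ<n; toℕ-fromℕ<; toℕ-injective)
open import Data.List.Base as List
  using (List; []; _∷_; _++_; [_]; length; lookup; tabulate; filter; upTo; cartesianProductWith)
open import Data.List.Membership.Propositional using (_∈_; lose)
open import Data.List.Membership.Propositional.Properties
  using (∈-lookup; ∈-map⁺; ∈-map⁻; ∈-tabulate⁺; ∈-tabulate⁻; ∈-filter⁺; ∈-filter⁻; ∈-upTo⁺)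
open import Data.List.Relation.Unary.All as All using (_∷_)
import Data.List.Relation.Unary.All.Properties as All
open import Data.List.Relation.Unary.Any as Any using (Any; here)
import Data.List.Relation.Unary.Any.Properties as Any
open import Data.Nat.Base
  using (ℕ; zero; suc; pred; _+_; _*_; _%_; _/_; _!; _≤_; _<_; _<′_; ≤′-refl; ≤′-step; z≤n; s≤s; NonZero)
open import Data.Nat.DivMod
  using (_mod_; m%n<n; m<n⇒m%n≡m; m%n%n≡m%n; %-distribˡ-+; %-remove-+ˡ; m≡m%n+[m/n]*n; m∣n⇒o%n%m≡o%m)
open import Data.Nat.Divisibility
  using (_∣_; divides; ∣-refl; ∣-reflexive; ∣-trans; ∣⇒≤; >⇒∤; ∣1⇒≡1; ∣m+n∣m⇒∣n; m∣m*n; m≤n⇒m!∣n!)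
open import Data.Nat.GCD using (gcd)
open import Data.Nat.GeneralisedArithmetic using (fold; fold-+)
open import Data.Nat.Induction using (<-rec)
open import Data.Nat.LCM using (lcm; m∣lcm[m,n]; n∣lcm[m,n]; lcm-least; gcd*lcm)
open import Data.Nat.ListAction using (product)
open import Data.Nat.ListAction.Properties using (∈⇒∣product)
open import Data.Nat.Primality using (Prime; ¬prime[0]; ¬prime[1])
open import Data.Nat.Primality.Factorisation
  using (factorise; factorisationHasAllPrimeFactors)
open import Data.Nat.Properties
  using ( +-comm; +-cancelʳ-≡; suc-pred; suc-injective; 1≤n!; m*n≢0; m*n≢0⇒n≢0
        ; ≤-refl; ≤-trans; ≤-antisym; <-trans; <⇒≤; <⇒≢; >⇒≢; ≰⇒>; ≤⇒≤′; <-cmp; m<n⇒m<1+n; m<1+n⇒m<n∨m≡n)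
open import Data.Product.Base using (∃-syntax; _×_; _,_; proj₁; proj₂)
open import Data.Product.Properties.WithK using (,-injectiveʳ)
open import Data.Sum.Base using (_⊎_; inj₁; inj₂; [_,_]′) renaming (map to map-⊎)
open import Function.Base using (_∘_; id)
open import Function.Bundles using (mk⇔; module Equivalence; module Injection; module Inverse)
open import Function.Construct.Identity using (↔-id; ⇔-id)
open import Function.Construct.Symmetry using (↔-sym)
open import Function.Properties.Inverse using (↔⇒↣)
open import Level using (_⊔_; Lift; lift; lower) renaming (zero to 0ℓ)
open import Relation.Binary.Bundles using (Poset)
open import Relation.Binary.Construct.Interior.Symmetric using () renaming (_,_ to _,ˢ_)
open import Relation.Binary.Core using (Rel; _⇔_)
open import Relation.Binary.Definitions using (Decidable; Transitive; tri<; tri≈; tri>)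
open import Relation.Binary.PropositionalEquality
  using (_≡_; _≢_; refl; sym; trans; cong; subst; subst₂; module ≡-Reasoning)
open import Relation.Nullary.Decidable.Core using (Dec; yes; no; map′)
open import Relation.Nullary.Negation using (contradiction)

-- Oriented 2-regular graphs and the homomorphisms between them.

-- A 2-regular graph together with an orientation of each of its components.
record Rotation (G : Graph) : Set where
  field
    next prev     : V G → V G
    next-prev     : ∀ v → next (prev v) ≡ v
    prev-next     : ∀ v → prev (next v) ≡ v
    next²≢        : ∀ v → next (next v) ≢ v
    next-adjacent : ∀ v → Adj G v (next v)
    adjacent⇒next : ∀ {u v} → Adj G u v → next u ≡ v ⊎ next v ≡ u

  next-injective : ∀ {u v} → next u ≡ next v → u ≡ v
  next-injective {u} {v} eq = trans (sym (prev-next u)) (trans (cong prev eq) (prev-next v))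

  adjacent-next : ∀ v → Adj G (next v) v
  adjacent-next v = Graph.symmetric G (next-adjacent v)

  prev-adjacent : ∀ v → Adj G v (prev v)
  prev-adjacent v = subst (λ u → Adj G u (prev v)) (next-prev v) (adjacent-next (prev v))

fold-suc : ∀ {A : Set} (z : A) (s : A → A) t → fold (s z) s t ≡ s (fold z s t)
fold-suc z s t = trans (sym (fold-+ z s t {1})) (cong (fold z s) (+-comm t 1))

fold-invariant : ∀ {A : Set} (P : A → Set) {s : A → A} → (∀ {x} → P x → P (s x)) →
                 ∀ {z} → P z → ∀ t → P (fold z s t)
fold-invariant P step base zero    = base
fold-invariant P step base (suc t) = step (fold-invariant P step base t)

module _ {G H : Graph} (r : Rotation G) (r′ : Rotation H) where
  private
    module G = Rotation r
    module H = Rotation r′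

  TurnFree : Hom G H → Set
  TurnFree f = ∀ v → map f (G.next (G.next v)) ≢ map f v

  -- Both `next (next v)` and `v` are neighbours of `next v`, and they are distinct.
  injective⇒turnFree : (f : Hom G H) → LocallyInjective f → TurnFree f
  injective⇒turnFree f inj v eq = G.next²≢ v
    (inj (G.next v) {G.next (G.next v) , G.next-adjacent (G.next v)} {v , G.adjacent-next v} eq)

  -- The only neighbours of `next v` are `v` and `next (next v)`. If `f` identified them, their
  -- common image would be the only neighbour of `c`, yet `H.next c` and `H.prev c` are distinct.
  surjective⇒turnFree : (f : Hom G H) → LocallySurjective f → TurnFree f
  surjective⇒turnFree f surj v eq = H.next²≢ (H.prev c) (begin
    H.next (H.next (H.prev c)) ≡⟨ cong H.next (H.next-prev c) ⟩
    H.next c                   ≡⟨ unique (H.next-adjacent c) ⟩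
    map f v                    ≡⟨ unique (H.prev-adjacent c) ⟨
    H.prev c                   ∎)
    where
    open ≡-Reasoning
    c = map f (G.next v)

    unique : ∀ {y} → Adj H c y → y ≡ map f v
    unique {y} c~y with surj (G.next v) (y , c~y)
    ... | (u , v′~u) , onto with G.adjacent⇒next v′~u
    ...   | inj₁ refl = trans (sym (onto {u , v′~u} refl)) eq
    ...   | inj₂ u≡v  = trans (sym (onto {u , v′~u} refl)) (cong (map f) (G.next-injective u≡v))

  module _ (f : Hom G H) (turnFree : TurnFree f) where
    private
      Forward Backward : V G → Set
      Forward  v = map f (G.next v) ≡ H.next (map f v)
      Backward v = H.next (map f (G.next v)) ≡ map f v

      direction : ∀ v → Forward v ⊎ Backward v
      direction v = map-⊎ sym id (H.adjacent⇒next (preserves f (G.next-adjacent v)))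

      -- A reversal at `next v` would bring the image of `next (next v)` back to that of `v`;
      -- `backward-next` is the mirror case.
      forward-next : ∀ {v} → Forward v → Forward (G.next v)
      forward-next {v} fw with direction (G.next v)
      ... | inj₁ fw′ = fw′
      ... | inj₂ bw  = ⊥-elim (turnFree v (H.next-injective (trans bw fw)))

      backward-next : ∀ {v} → Backward v → Backward (G.next v)
      backward-next {v} bw with direction (G.next v)
      ... | inj₁ fw  = ⊥-elim (turnFree v (trans fw bw))
      ... | inj₂ bw′ = bw′

      forward-fold : ∀ v → Forward v → ∀ t → map f (fold v G.next t) ≡ fold (map f v) H.next t
      forward-fold v fw zero    = refl
      forward-fold v fw (suc t) =
        trans (fold-invariant Forward forward-next fw t) (cong H.next (forward-fold v fw t))

      backward-fold : ∀ v → Backward v → ∀ t → fold (map f (fold v G.next t)) H.next t ≡ map f v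
      backward-fold v bw zero    = refl
      backward-fold v bw (suc t) = begin
        -- The outermost step is moved to the start of the walk in `H`, where `Backward u` cancels
        -- it against the last step in `G`.
        H.next (fold (map f (G.next u)) H.next t) ≡⟨ fold-suc (map f (G.next u)) H.next t ⟨
        fold (H.next (map f (G.next u))) H.next t ≡⟨ cong (λ z → fold z H.next t) (fold-invariant Backward backward-next bw t) ⟩
        fold (map f u) H.next t                   ≡⟨ backward-fold v bw t ⟩
        map f v                                   ∎
        where
        open ≡-Reasoning
        u = fold v G.next t

    closedWalk-image : ∀ v t → fold v G.next t ≡ v → fold (map f v) H.next t ≡ map f v
    closedWalk-image v t closed with direction v
    ... | inj₁ fw = trans (sym (forward-fold v fw t)) (cong (map f) closed)
    ... | inj₂ bw = trans (cong (λ u → fold (map f u) H.next t) (sym closed)) (backward-fold v bw t)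

  -- The two neighbours `next v` and `prev v` go to the successor and the predecessor of `g v`,
  -- which are distinct and are all its neighbours.
  equivariant⇒≤ᴸᴮ : (g : V G → V H) → (∀ v → g (G.next v) ≡ H.next (g v)) → G ≤ᴸᴮ H
  equivariant⇒≤ᴸᴮ g g-next = hom g pres , λ v →
      (λ {x} {y} → inj v (proj₂ x) (proj₂ y))
    , λ (y , gv~y) → let u , v~u , gu≡y = surj v gv~y in
        (u , v~u) , λ z≡u → trans (cong g z≡u) gu≡y
    where
    pres : ∀ {u v} → Adj G u v → Adj H (g u) (g v)
    pres {u} {v} u~v with G.adjacent⇒next u~v
    ... | inj₁ refl = subst (Adj H (g u)) (sym (g-next u)) (H.next-adjacent (g u))
    ... | inj₂ refl = subst (λ w → Adj H w (g v)) (sym (g-next v)) (H.adjacent-next (g v))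

    turn : ∀ {u v} → G.next v ≡ u → g u ≢ g (G.prev v)
    turn {v = v} refl eq = H.next²≢ (g (G.prev v)) (begin
      H.next (H.next (g (G.prev v))) ≡⟨ cong H.next (g-next (G.prev v)) ⟨
      H.next (g (G.next (G.prev v))) ≡⟨ cong (H.next ∘ g) (G.next-prev v) ⟩
      H.next (g v)                   ≡⟨ g-next v ⟨
      g (G.next v)                   ≡⟨ eq ⟩
      g (G.prev v)                   ∎)
      where open ≡-Reasoning

    inj : ∀ v {x y} → Adj G v x → Adj G v y → g x ≡ g y → x ≡ y
    inj v {x} {y} v~x v~y eq with G.adjacent⇒next v~x | G.adjacent⇒next v~y
    ... | inj₁ p    | inj₁ q    = trans (sym p) q
    ... | inj₂ p    | inj₂ q    = G.next-injective (trans p (sym q))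
    ... | inj₁ p    | inj₂ refl = ⊥-elim (turn p (trans eq (cong g (sym (G.prev-next y)))))
    ... | inj₂ refl | inj₁ q    = ⊥-elim (turn q (trans (sym eq) (cong g (sym (G.prev-next x)))))

    surj : ∀ v {y} → Adj H (g v) y → ∃[ u ] Adj G v u × g u ≡ y
    surj v gv~y with H.adjacent⇒next gv~y
    ... | inj₁ p = G.next v , G.next-adjacent v , trans (g-next v) p
    ... | inj₂ p = G.prev v , G.prev-adjacent v , H.next-injective
      (trans (sym (g-next (G.prev v))) (trans (cong g (G.next-prev v)) (sym p)))

-- Isomorphisms as locally bijective homomorphisms.

≅⇒≤ᴸᴮ : ∀ {G H} → G ≅ H → G ≤ᴸᴮ H
≅⇒≤ᴸᴮ {G} {H} (iso , adj⇔) = hom to (Equivalence.to adj⇔) , λ v →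
    Injection.injective (↔⇒↣ iso)
  , λ (y , v~y) →
      ( from y
      , Equivalence.from adj⇔ (subst (Adj H (to v)) (sym (strictlyInverseˡ y)) v~y))
    , λ z≡u → trans (cong to z≡u) (strictlyInverseˡ y)
  where open Inverse iso

≅-sym : ∀ {G H} → G ≅ H → H ≅ G
≅-sym {H = H} (iso , adj⇔) = ↔-sym iso , λ {u} {v} → mk⇔
  (λ u~v → Equivalence.from adj⇔
    (subst₂ (Adj H) (sym (strictlyInverseˡ u)) (sym (strictlyInverseˡ v)) u~v))
  (λ u~v → subst₂ (Adj H) (strictlyInverseˡ u) (strictlyInverseˡ v) (Equivalence.to adj⇔ u~v))
  where open Inverse iso

-- The rotation of a cycle and of a disjoint union of cycles.

suc[m%n]%n≡suc[m]%n : ∀ m n .{{_ : NonZero n}} → suc (m % n) % n ≡ suc m % n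
suc[m%n]%n≡suc[m]%n m n = begin
  suc (m % n) % n         ≡⟨ %-distribˡ-+ 1 (m % n) n ⟩
  (1 % n + m % n % n) % n ≡⟨ cong (λ r → (1 % n + r) % n) (m%n%n≡m%n m n) ⟩
  (1 % n + m % n) % n     ≡⟨ %-distribˡ-+ 1 m n ⟨
  suc m % n               ∎
  where open ≡-Reasoning

module _ {k : ℕ} .{{_ : NonZero k}} where

  toℕ-mod : ∀ m → toℕ (m mod k) ≡ m % k
  toℕ-mod m = toℕ-fromℕ< (m%n<n m k)

  nextFin : Fin k → Fin k
  nextFin u = suc (toℕ u) mod k

  toℕ-fold-nextFin : ∀ u t → toℕ (fold u nextFin t) ≡ (t + toℕ u) % k
  toℕ-fold-nextFin u zero    = sym (m<n⇒m%n≡m (toℕ<n u))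
  toℕ-fold-nextFin u (suc t) = begin
    toℕ (nextFin (fold u nextFin t))   ≡⟨ toℕ-mod _ ⟩
    suc (toℕ (fold u nextFin t)) % k   ≡⟨ cong (λ m → suc m % k) (toℕ-fold-nextFin u t) ⟩
    suc ((t + toℕ u) % k) % k          ≡⟨ suc[m%n]%n≡suc[m]%n (t + toℕ u) k ⟩
    suc (t + toℕ u) % k                ∎
    where open ≡-Reasoning

  fold-nextFin-period : ∀ u → fold u nextFin k ≡ u
  fold-nextFin-period u = toℕ-injective (begin
    toℕ (fold u nextFin k) ≡⟨ toℕ-fold-nextFin u k ⟩
    (k + toℕ u) % k        ≡⟨ %-remove-+ˡ (toℕ u) ∣-refl ⟩
    toℕ u % k              ≡⟨ m<n⇒m%n≡m (toℕ<n u) ⟩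
    toℕ u                  ∎)
    where open ≡-Reasoning

  -- The residue of `t + toℕ u` is `toℕ u`, so cancelling `toℕ u` in the division by `k` leaves `t`
  -- as a multiple of `k`.
  fold-nextFin-closed⇒∣ : ∀ u t → fold u nextFin t ≡ u → k ∣ t
  fold-nextFin-closed⇒∣ u t closed = divides q (+-cancelʳ-≡ (toℕ u) t (q * k) (begin
    t + toℕ u                   ≡⟨ m≡m%n+[m/n]*n (t + toℕ u) k ⟩
    (t + toℕ u) % k + q * k     ≡⟨ cong (_+ q * k) (toℕ-fold-nextFin u t) ⟨
    toℕ (fold u nextFin t) + q * k ≡⟨ cong (λ v → toℕ v + q * k) closed ⟩
    toℕ u + q * k               ≡⟨ +-comm (toℕ u) (q * k) ⟩
    q * k + toℕ u               ∎))
    where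
    open ≡-Reasoning
    q = (t + toℕ u) / k

module _ (k : ℕ) (3≤k : 3 ≤ k) where
  private instance
    _ : NonZero k
    _ = 3≤⇒nonZero 3≤k

  C-rotation : Rotation (C k 3≤k)
  C-rotation = record
    { next          = nextFin
    -- Since `k` rotations are the identity, `pred k` of them invert one.
    ; prev          = λ u → fold u nextFin (pred k)
    ; next-prev     = λ u → trans (cong (fold u nextFin) (suc-pred k)) (fold-nextFin-period u)
    ; prev-next     = λ u → trans (fold-suc u nextFin (pred k))
                        (trans (cong (fold u nextFin) (suc-pred k)) (fold-nextFin-period u))
    -- A closed walk of two steps would make `k` a divisor of 2.
    ; next²≢        = λ u closed → >⇒∤ 3≤k (fold-nextFin-closed⇒∣ u 2 closed)
    ; next-adjacent = λ u → inj₁ (sym (toℕ-mod (suc (toℕ u))))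
    ; adjacent⇒next = map-⊎ Next⇒next Next⇒next
    }
    where
    Next⇒next : ∀ {u v} → Next k u v → nextFin u ≡ v
    Next⇒next {u} u→v = toℕ-injective (trans (toℕ-mod (suc (toℕ u))) u→v)

module _ {I : Set} {G : I → Graph} (r : ∀ i → Rotation (G i)) where
  private
    module R i = Rotation (r i)

  ⨆-rotation : Rotation (⨆ G)
  ⨆-rotation = record
    { next          = λ (i , v) → i , R.next i v
    ; prev          = λ (i , v) → i , R.prev i v
    ; next-prev     = λ (i , v) → cong (i ,_) (R.next-prev i v)
    ; prev-next     = λ (i , v) → cong (i ,_) (R.prev-next i v)
    ; next²≢        = λ (i , v) eq → R.next²≢ i v (,-injectiveʳ eq)
    ; next-adjacent = λ (i , v) → within (R.next-adjacent i v)
    ; adjacent⇒next = λ { (within {i} e) →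
        map-⊎ (cong (i ,_)) (cong (i ,_)) (R.adjacent⇒next i e) }
    }

  ⨆-fold-next : ∀ i v t → fold (i , v) (Rotation.next ⨆-rotation) t ≡ (i , fold v (R.next i) t)
  ⨆-fold-next i v zero    = refl
  ⨆-fold-next i v (suc t) = cong (Rotation.next ⨆-rotation) (⨆-fold-next i v t)

-- Divisibility between families of cycle lengths.

infix 4 _≼_

-- Equivalently, every multiple of some `k i` is a multiple of some `m j`.
_≼_ : ∀ {I J : Set} → (I → ℕ) → (J → ℕ) → Set
k ≼ m = ∀ i → ∃[ j ] m j ∣ k i

≼-refl : ∀ {I : Set} {k : I → ℕ} → k ≼ k
≼-refl i = i , ∣-refl

≼-trans : ∀ {I J K : Set} {k : I → ℕ} {m : J → ℕ} {n : K → ℕ} → k ≼ m → m ≼ n → k ≼ n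
≼-trans k≼m m≼n i =
  let j , mⱼ∣kᵢ = k≼m i
      l , nₗ∣mⱼ = m≼n j
  in l , ∣-trans nₗ∣mⱼ mⱼ∣kᵢ

module _ {I J : Set} {k : I → ℕ} {m : J → ℕ} (3≤k : ∀ i → 3 ≤ k i) (3≤m : ∀ j → 3 ≤ m j) where
  private
    rᵏ = ⨆-rotation (λ i → C-rotation (k i) (3≤k i))
    rᵐ = ⨆-rotation (λ j → C-rotation (m j) (3≤m j))

    ⨆Cᵏ = ⨆ (λ i → C (k i) (3≤k i))
    ⨆Cᵐ = ⨆ (λ j → C (m j) (3≤m j))

    instance
      nonZeroᵏ : ∀ {i} → NonZero (k i)
      nonZeroᵏ {i} = 3≤⇒nonZero (3≤k i)

      nonZeroᵐ : ∀ {j} → NonZero (m j)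
      nonZeroᵐ {j} = 3≤⇒nonZero (3≤m j)

  -- One full turn of the cycle `i` is a closed walk of `k i` steps. Its image closes up after as
  -- many steps, so the length of the cycle containing it divides `k i`.
  turnFree⇒≼ : (f : Hom ⨆Cᵏ ⨆Cᵐ) → TurnFree rᵏ rᵐ f → k ≼ m
  turnFree⇒≼ f turnFree i = proj₁ y , fold-nextFin-closed⇒∣ (proj₂ y) (k i)
    (,-injectiveʳ (trans (sym (⨆-fold-next (λ j → C-rotation (m j) (3≤m j)) (proj₁ y) (proj₂ y) (k i)))
      (closedWalk-image rᵏ rᵐ f turnFree (i , u) (k i)
        (trans (⨆-fold-next (λ i → C-rotation (k i) (3≤k i)) i u (k i)) (cong (i ,_) (fold-nextFin-period u))))))
    where
    u : Fin (k i)
    u = 0 mod k i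

    y : V ⨆Cᵐ
    y = map f (i , u)

  ≤ᴸᴵ⇒≼ : ⨆Cᵏ ≤ᴸᴵ ⨆Cᵐ → k ≼ m
  ≤ᴸᴵ⇒≼ (f , inj) = turnFree⇒≼ f (injective⇒turnFree rᵏ rᵐ f inj)

  ≤ᴸˢ⇒≼ : ⨆Cᵏ ≤ᴸˢ ⨆Cᵐ → k ≼ m
  ≤ᴸˢ⇒≼ (f , surj) = turnFree⇒≼ f (surjective⇒turnFree rᵏ rᵐ f surj)

  ≼⇒≤ᴸᴮ : k ≼ m → ⨆Cᵏ ≤ᴸᴮ ⨆Cᵐ
  ≼⇒≤ᴸᴮ k≼m = equivariant⇒≤ᴸᴮ rᵏ rᵐ wrap wrap-next
    where
    wrap : V ⨆Cᵏ → V ⨆Cᵐ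
    wrap (i , u) = proj₁ (k≼m i) , toℕ u mod m (proj₁ (k≼m i))

    wrap-next : ∀ v → wrap (Rotation.next rᵏ v) ≡ Rotation.next rᵐ (wrap v)
    wrap-next (i , u) = cong (proj₁ (k≼m i) ,_) (toℕ-injective (begin
      toℕ (toℕ (nextFin u) mod n)    ≡⟨ toℕ-mod _ ⟩
      toℕ (nextFin u) % n            ≡⟨ cong (_% n) (toℕ-mod _) ⟩
      -- The wrap-around from `k i` to 0 is invisible modulo `n` because `n` divides `k i`.
      suc (toℕ u) % k i % n          ≡⟨ m∣n⇒o%n%m≡o%m n (k i) (suc (toℕ u)) (proj₂ (k≼m i)) ⟩
      suc (toℕ u) % n                ≡⟨ suc[m%n]%n≡suc[m]%n (toℕ u) n ⟨
      suc (toℕ u % n) % n            ≡⟨ cong (λ r → suc r % n) (toℕ-mod _) ⟨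
      suc (toℕ (toℕ u mod n)) % n    ≡⟨ toℕ-mod _ ⟨
      toℕ (nextFin (toℕ u mod n))    ∎))
      where
      open ≡-Reasoning
      n = m (proj₁ (k≼m i))

-- The three orders on `Cycles` in terms of lengths.

≤ᴸᴮ⇒≤ᴸᴵ : ∀ {G H} → G ≤ᴸᴮ H → G ≤ᴸᴵ H
≤ᴸᴮ⇒≤ᴸᴵ (f , bij) = f , λ v {x} {y} → proj₁ (bij v) {x} {y}

≤ᴸᴮ⇒≤ᴸˢ : ∀ {G H} → G ≤ᴸᴮ H → G ≤ᴸˢ H
≤ᴸᴮ⇒≤ᴸˢ (f , bij) = f , λ v → proj₂ (bij v)

lengths : (G : Cycles) → Fin (proj₁ (isCycles G)) → ℕ
lengths G = proj₁ (proj₂ (isCycles G))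

module _ (G H : Cycles) where
  private
    3≤G = proj₁ (proj₂ (proj₂ (isCycles G)))
    3≤H = proj₁ (proj₂ (proj₂ (isCycles H)))

    ⨆G = ⨆ (λ i → C (lengths G i) (3≤G i))
    ⨆H = ⨆ (λ i → C (lengths H i) (3≤H i))

    ≅G : graph G ≅ ⨆G
    ≅G = proj₂ (proj₂ (proj₂ (isCycles G)))

    ≅H : graph H ≅ ⨆H
    ≅H = proj₂ (proj₂ (proj₂ (isCycles H)))

    G≤ : graph G ≤ᴸᴮ ⨆G
    G≤ = ≅⇒≤ᴸᴮ ≅G

    ≤G : ⨆G ≤ᴸᴮ graph G
    ≤G = ≅⇒≤ᴸᴮ {⨆G} {graph G} (≅-sym {graph G} {⨆G} ≅G)

    H≤ : graph H ≤ᴸᴮ ⨆H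
    H≤ = ≅⇒≤ᴸᴮ ≅H

    ≤H : ⨆H ≤ᴸᴮ graph H
    ≤H = ≅⇒≤ᴸᴮ {⨆H} {graph H} (≅-sym {graph H} {⨆H} ≅H)

  lengths-≤ᴸᴵ : graph G ≤ᴸᴵ graph H → lengths G ≼ lengths H
  lengths-≤ᴸᴵ G≤H = ≤ᴸᴵ⇒≼ 3≤G 3≤H
    (≤ᴸᴵ-trans {⨆G} {graph H} {⨆H}
      (≤ᴸᴵ-trans {⨆G} {graph G} {graph H} (≤ᴸᴮ⇒≤ᴸᴵ {⨆G} {graph G} ≤G) G≤H)
      (≤ᴸᴮ⇒≤ᴸᴵ {graph H} {⨆H} H≤))

  lengths-≤ᴸˢ : graph G ≤ᴸˢ graph H → lengths G ≼ lengths H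
  lengths-≤ᴸˢ G≤H = ≤ᴸˢ⇒≼ 3≤G 3≤H
    (≤ᴸˢ-trans {⨆G} {graph H} {⨆H}
      (≤ᴸˢ-trans {⨆G} {graph G} {graph H} (≤ᴸᴮ⇒≤ᴸˢ {⨆G} {graph G} ≤G) G≤H)
      (≤ᴸᴮ⇒≤ᴸˢ {graph H} {⨆H} H≤))

  lengths-≼⇒≤ᴸᴮ : lengths G ≼ lengths H → graph G ≤ᴸᴮ graph H
  lengths-≼⇒≤ᴸᴮ G≼H =
    ≤ᴸᴮ-trans {graph G} {⨆H} {graph H}
      (≤ᴸᴮ-trans {graph G} {⨆G} {⨆H} G≤ (≼⇒≤ᴸᴮ 3≤G 3≤H G≼H)) ≤H

-- Primes and the encoding of finite sets.

-- Euclid's argument: a prime factor of `n ! + 1` that is at most `n` would divide `n !`, hence 1.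
prime> : ∀ n → ∃[ p ] Prime p × n < p
prime> n with factorise (suc (n !))
... | record { factors = [] ; isFactorisation = eq } =
  -- An empty factorisation would mean `suc (n !) ≡ 1`, but `n !` is positive.
  contradiction (suc-injective eq) (>⇒≢ (1≤n! n))
... | record { factors = p ∷ ps ; isFactorisation = eq ; factorsPrime = pp ∷ _ } =
  p , pp , ≰⇒> λ p≤n → ¬prime[1] (subst Prime (∣1⇒≡1 (∣m+n∣m⇒∣n p∣n!+1 (∣! p≤n pp))) pp)
  where
  p∣n!+1 = subst (p ∣_) (trans (sym eq) (+-comm 1 (n !))) (m∣m*n (product ps))

  ∣! : ∀ {p} → p ≤ n → Prime p → p ∣ n !
  ∣! {zero}  _   p0 = contradiction p0 ¬prime[0]
  ∣! {suc p} p≤n _  = ∣-trans (m∣m*n (p !)) (m≤n⇒m!∣n! p≤n)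

-- An increasing sequence of primes, not necessarily consecutive; it starts above 2 so that each
-- member is the length of a cycle.
oddPrime : ℕ → ℕ
oddPrime zero    = proj₁ (prime> 2)
oddPrime (suc n) = proj₁ (prime> (oddPrime n))

prime[oddPrime] : ∀ n → Prime (oddPrime n)
prime[oddPrime] zero    = proj₁ (proj₂ (prime> 2))
prime[oddPrime] (suc n) = proj₁ (proj₂ (prime> (oddPrime n)))

oddPrime<oddPrime[1+_] : ∀ n → oddPrime n < oddPrime (suc n)
oddPrime<oddPrime[1+ n ] = proj₂ (proj₂ (prime> (oddPrime n)))

3≤oddPrime : ∀ n → 3 ≤ oddPrime n
3≤oddPrime zero    = proj₂ (proj₂ (prime> 2))
3≤oddPrime (suc n) = ≤-trans (3≤oddPrime n) (<⇒≤ oddPrime<oddPrime[1+ n ])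

oddPrime-mono-< : ∀ {m n} → m <′ n → oddPrime m < oddPrime n
oddPrime-mono-< {m} ≤′-refl            = oddPrime<oddPrime[1+ m ]
oddPrime-mono-< {n = suc n} (≤′-step m<n) = <-trans (oddPrime-mono-< m<n) oddPrime<oddPrime[1+ n ]

oddPrime-injective : ∀ {m n} → oddPrime m ≡ oddPrime n → m ≡ n
oddPrime-injective {m} {n} eq with <-cmp m n
... | tri< m<n _ _ = contradiction eq (<⇒≢ (oddPrime-mono-< (≤⇒≤′ m<n)))
... | tri≈ _ m≡n _ = m≡n
... | tri> _ _ m>n = contradiction eq (>⇒≢ (oddPrime-mono-< (≤⇒≤′ m>n)))

-- Turns membership into divisibility; the order and multiplicity of the entries do not affect which
-- `oddPrime n` divide the result.
encode : List ℕ → ℕ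
encode ns = product (List.map oddPrime ns)

∈⇒∣encode : ∀ {n ns} → n ∈ ns → oddPrime n ∣ encode ns
∈⇒∣encode n∈ns = ∈⇒∣product (∈-map⁺ oddPrime n∈ns)

-- A prime dividing a product of primes is one of the factors, and `oddPrime` is injective.
∣encode⇒∈ : ∀ {n ns} → oddPrime n ∣ encode ns → n ∈ ns
∣encode⇒∈ {n} {ns} q∣c
  with m , m∈ns , eq ← ∈-map⁻ oddPrime (factorisationHasAllPrimeFactors (prime[oddPrime] n) q∣c
         (All.map⁺ (All.tabulate λ {m} _ → prime[oddPrime] m)))
  = subst (_∈ ns) (sym (oddPrime-injective eq)) m∈ns

-- Countability by least codes.

least : ∀ {p} {P : ℕ → Set p} → (∀ n → Dec (P n)) → ∀ {n} → P n →
        ∃[ m ] P m × (∀ {l} → P l → m ≤ l)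
least P? {zero}  Pn = zero , Pn , λ _ → z≤n
least {P = P} P? {suc n} Pn with P? zero
... | yes P0 = zero , P0 , λ _ → z≤n
... | no ¬P0 with least (P? ∘ suc) Pn
...   | m , Pm , minimal = suc m , Pm , minimal′
  where
  minimal′ : ∀ {l} → P l → suc m ≤ l
  minimal′ {zero}  P0 = contradiction P0 ¬P0
  minimal′ {suc l} Pl = s≤s (minimal Pl)

-- The numbers that c encodes, as a family indexed by the primes dividing c.
exponents : (c : ℕ) → ∃[ n ] oddPrime n ∣ c → ℕ
exponents c = proj₁

-- Comparing multiples instead of the lengths themselves makes this invariant under mutual
-- comparability.
Codes : {I : Set} → ℕ → (I → ℕ) → Set
Codes c k = k ≼ exponents c × exponents c ≼ k

codes-resp : ∀ {I J : Set} {k : I → ℕ} {m : J → ℕ} {c} → k ≼ m → m ≼ k → Codes c k → Codes c m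
codes-resp {k = k} {m} {c} k≼m m≼k (k≼c , c≼k) =
  ≼-trans {m = k} {n = exponents c} m≼k k≼c , ≼-trans {k = exponents c} {m = k} {n = m} c≼k k≼m

encode-codes : ∀ {n} (k : Fin n → ℕ) → Codes (encode (tabulate k)) k
encode-codes k =
    (λ i → (k i , ∈⇒∣encode (∈-tabulate⁺ i)) , ∣-refl)
  , λ (m , q∣c) → let i , m≡kᵢ = ∈-tabulate⁻ (∣encode⇒∈ q∣c) in i , ∣-reflexive (sym m≡kᵢ)

Cycles-countable : ExcludedMiddle 0ℓ → Countable Cycles-LB
Cycles-countable em = record
  { to        = code
  -- Equivalent graphs have the same codes, so each least code bounds the other.
  ; cong      = λ {G} {H} (G≤H ,ˢ H≤G) → ≤-antisym
      (code-least G (codes-resp (≤ᴸᴮ⇒≼ H G H≤G) (≤ᴸᴮ⇒≼ G H G≤H) (code-codes H)))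
      (code-least H (codes-resp (≤ᴸᴮ⇒≼ G H G≤H) (≤ᴸᴮ⇒≼ H G H≤G) (code-codes G)))
  ; injective = λ {G} {H} eq →
      lengths-≼⇒≤ᴸᴮ G H (comparable G H eq) ,ˢ lengths-≼⇒≤ᴸᴮ H G (comparable H G (sym eq))
  }
  where
  ≤ᴸᴮ⇒≼ : ∀ G H → graph G ≤ᴸᴮ graph H → lengths G ≼ lengths H
  ≤ᴸᴮ⇒≼ G H G≤H = lengths-≤ᴸᴵ G H (≤ᴸᴮ⇒≤ᴸᴵ {graph G} {graph H} G≤H)

  leastCode : ∀ G → ∃[ c ] Codes c (lengths G) × (∀ {l} → Codes l (lengths G) → c ≤ l)
  leastCode G = least (λ _ → em) (encode-codes (lengths G))

  code : Cycles → ℕ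
  code G = proj₁ (leastCode G)

  code-codes : ∀ G → Codes (code G) (lengths G)
  code-codes G = proj₁ (proj₂ (leastCode G))

  code-least : ∀ G {c} → Codes c (lengths G) → code G ≤ c
  code-least G = proj₂ (proj₂ (leastCode G))

  comparable : ∀ G H → code G ≡ code H → lengths G ≼ lengths H
  comparable G H eq = ≼-trans {m = exponents (code H)} {n = lengths H}
    (subst (λ c → lengths G ≼ exponents c) eq (proj₁ (code-codes G))) (proj₂ (code-codes H))

-- Lists of lengths as positive formulas.

Length : Set
Length = ∃[ k ] 3 ≤ k

disjointCycles : List Length → Cycles
disjointCycles ks = record
  { graph    = ⨆ λ i → C (proj₁ (lookup ks i)) (proj₂ (lookup ks i))
  ; isCycles = length ks , proj₁ ∘ lookup ks , proj₂ ∘ lookup ks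
             , ↔-id _ , ⇔-id _
  }

infix 4 _∈↑_

_∈↑_ : ℕ → List Length → Set
n ∈↑ ks = Any (λ k → proj₁ k ∣ n) ks

-- Each length in `ks` is a multiple of itself; testing the inclusion there gives a length in `ms`
-- dividing it.
⊆↑⇒≤ᴸᴮ : ∀ {ks ms} → (∀ {n} → n ∈↑ ks → n ∈↑ ms) →
         graph (disjointCycles ks) ≤ᴸᴮ graph (disjointCycles ms)
⊆↑⇒≤ᴸᴮ {ks} {ms} ⊆ = lengths-≼⇒≤ᴸᴮ (disjointCycles ks) (disjointCycles ms) λ i →
  let p = ⊆ (lose (∈-lookup {xs = ks} i) ∣-refl)
  in Any.index p , Any.lookup-index p

≤ᴸᴮ⇒⊆↑ : ∀ {ks ms} → graph (disjointCycles ks) ≤ᴸᴮ graph (disjointCycles ms) →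
         ∀ {n} → n ∈↑ ks → n ∈↑ ms
≤ᴸᴮ⇒⊆↑ {ks} {ms} ks≤ms p =
  let j , mⱼ∣kᵢ = lengths-≤ᴸᴵ (disjointCycles ks) (disjointCycles ms)
        (≤ᴸᴮ⇒≤ᴸᴵ {graph (disjointCycles ks)} {graph (disjointCycles ms)} ks≤ms) (Any.index p)
  in lose (∈-lookup {xs = ms} j) (∣-trans mⱼ∣kᵢ (Any.lookup-index p))

-- The bound survives because the lcm is a multiple of `k`, nonzero since its product with the gcd
-- is `k * m`.
lcmᴸ : Length → Length → Length
lcmᴸ (k , 3≤k) (m , 3≤m) =
  lcm k m , ≤-trans 3≤k (∣⇒≤ {{lcm≢0 3≤k 3≤m}} (m∣lcm[m,n] k m))
  where
  lcm≢0 : ∀ {k m} → 3 ≤ k → 3 ≤ m → NonZero (lcm k m)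
  lcm≢0 {k} {m} 3≤k 3≤m = m*n≢0⇒n≢0 (gcd k m) {{subst NonZero (sym (gcd*lcm k m))
    (m*n≢0 k m {{3≤⇒nonZero 3≤k}} {{3≤⇒nonZero 3≤m}})}}

infixr 7 _⊓ᴸ_

_⊓ᴸ_ : List Length → List Length → List Length
_⊓ᴸ_ = cartesianProductWith lcmᴸ

∈↑-⊓⁺ : ∀ {n} ks ms → n ∈↑ ks → n ∈↑ ms → n ∈↑ ks ⊓ᴸ ms
∈↑-⊓⁺ ks ms = Any.cartesianProductWith⁺ lcmᴸ lcm-least

∈↑-⊓⁻ : ∀ {n} ks ms → n ∈↑ ks ⊓ᴸ ms → n ∈↑ ks × n ∈↑ ms
∈↑-⊓⁻ ks ms = Any.cartesianProductWith⁻ lcmᴸ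
  (λ {(k , _)} {(m , _)} lcm∣n → ∣-trans (m∣lcm[m,n] k m) lcm∣n , ∣-trans (n∣lcm[m,n] k m) lcm∣n) ks ms

-- The formulas of a decidable transitive relation on the naturals.

module Embedding {ℓ} {R : Rel ℕ ℓ} (R-trans : Transitive R) (R? : Decidable R) where

  -- Stage `j` of `meets n` and `joins n` takes in the `φ i` with `i < j`. This bound is separate
  -- from `n` so that the recursion can descend through it.
  φ : ℕ → List Length
  meets joins : ℕ → ℕ → List Length

  φ n = meets n n ++ joins n n

  meets n zero    = [ oddPrime n , 3≤oddPrime n ]
  meets n (suc i) with R? n i
  ... | yes _ = φ i ⊓ᴸ meets n i
  ... | no  _ = meets n i

  joins n zero    = []
  joins n (suc i) with R? i n
  ... | yes _ = φ i ++ joins n i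
  ... | no  _ = joins n i

  ∈↑-meets⁺ : ∀ {v} n j → oddPrime n ∣ v → (∀ {i} → i < j → R n i → v ∈↑ φ i) → v ∈↑ meets n j
  ∈↑-meets⁺ n zero    q∣v above = here q∣v
  ∈↑-meets⁺ n (suc i) q∣v above with R? n i
  ... | yes nRi = ∈↑-⊓⁺ (φ i) (meets n i) (above ≤-refl nRi) (∈↑-meets⁺ n i q∣v (above ∘ m<n⇒m<1+n))
  ... | no  _   = ∈↑-meets⁺ n i q∣v (above ∘ m<n⇒m<1+n)

  ∈↑-meets⁻ : ∀ {v} n j → v ∈↑ meets n j → oddPrime n ∣ v × (∀ {i} → i < j → R n i → v ∈↑ φ i)
  ∈↑-meets⁻ n zero    (here q∣v) = q∣v , λ ()
  ∈↑-meets⁻ n (suc i) v∈ with R? n i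
  ... | yes _ =
    let v∈φ , v∈meets = ∈↑-⊓⁻ (φ i) (meets n i) v∈
        q∣v , above   = ∈↑-meets⁻ n i v∈meets
    in q∣v , λ l<1+i nRl →
      [ (λ l<i → above l<i nRl) , (λ { refl → v∈φ }) ]′ (m<1+n⇒m<n∨m≡n l<1+i)
  ... | no ¬nRi =
    let q∣v , above = ∈↑-meets⁻ n i v∈
    in q∣v , λ l<1+i nRl →
      [ (λ l<i → above l<i nRl) , (λ { refl → contradiction nRl ¬nRi }) ]′ (m<1+n⇒m<n∨m≡n l<1+i)

  ∈↑-joins⁺ : ∀ {v} n j {i} → i < j → R i n → v ∈↑ φ i → v ∈↑ joins n j
  ∈↑-joins⁺ n (suc j) i<1+j iRn v∈ with R? j n | m<1+n⇒m<n∨m≡n i<1+j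
  ... | yes _   | inj₁ i<j  = Any.++⁺ʳ (φ j) (∈↑-joins⁺ n j i<j iRn v∈)
  ... | yes _   | inj₂ refl = Any.++⁺ˡ v∈
  ... | no _    | inj₁ i<j  = ∈↑-joins⁺ n j i<j iRn v∈
  ... | no ¬jRn | inj₂ refl = contradiction iRn ¬jRn

  ∈↑-joins⁻ : ∀ {v} n j → v ∈↑ joins n j → ∃[ i ] i < j × R i n × v ∈↑ φ i
  ∈↑-joins⁻ n (suc j) v∈ with R? j n
  ... | no _ = let i , i<j , rest = ∈↑-joins⁻ n j v∈ in i , m<n⇒m<1+n i<j , rest
  ... | yes jRn with Any.++⁻ (φ j) v∈
  ...   | inj₁ v∈φ     = j , ≤-refl , jRn , v∈φ
  ...   | inj₂ v∈joins = let i , i<j , rest = ∈↑-joins⁻ n j v∈joins in i , m<n⇒m<1+n i<j , rest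

  -- If `m < n`, then `φ m` is a disjunct of `φ n`. If `n < m`, then `φ n` is a conjunct in the
  -- first half of `φ m`, while a disjunct `φ i` of `φ m` has `R i n` by transitivity and is handled
  -- by induction.
  φ-mono : ∀ {v} m {n} → R m n → v ∈↑ φ m → v ∈↑ φ n
  φ-mono {v} = <-rec Mono mono
    where
    Mono : ℕ → Set ℓ
    Mono m = ∀ {n} → R m n → v ∈↑ φ m → v ∈↑ φ n

    mono : ∀ m → (∀ {i} → i < m → Mono i) → Mono m
    mono m rec {n} mRn v∈ with <-cmp m n
    ... | tri< m<n _ _  = Any.++⁺ʳ (meets n n) (∈↑-joins⁺ n n m<n mRn v∈)
    ... | tri≈ _ refl _ = v∈
    ... | tri> _ _ n<m with Any.++⁻ (meets m m) v∈
    ...   | inj₁ v∈meets = proj₂ (∈↑-meets⁻ m m v∈meets) n<m mRn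
    ...   | inj₂ v∈joins =
      let i , i<m , iRm , v∈φ = ∈↑-joins⁻ m m v∈joins in rec i<m (R-trans iRm mRn) v∈φ

  -- Only i ≤ z is needed to evaluate φ z, which makes the valuation a finite product.
  valuation : ℕ → ℕ
  valuation z = encode (filter (R? z) (upTo (suc z)))

  -- The conjunction already holds: `pₙ` is true, and each conjunct `φ i` has `R z i` by
  -- transitivity, so induction applies.
  valuation-satisfies : ∀ z n → n ≤ z → R z n → valuation z ∈↑ φ n
  valuation-satisfies z = <-rec _ λ n rec n≤z zRn → Any.++⁺ˡ (∈↑-meets⁺ n n
    (∈⇒∣encode (∈-filter⁺ (R? z) (∈-upTo⁺ (s≤s n≤z)) zRn))
    λ i<n nRi → rec i<n (≤-trans (<⇒≤ i<n) n≤z) (R-trans zRn nRi))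

  -- If the conjunction holds, so does `pₙ`, which gives `R z n`. Otherwise some `φ i` with `R i n`
  -- holds, and induction gives `R z i`.
  valuation-satisfies⁻ : ∀ z n → valuation z ∈↑ φ n → R z n
  valuation-satisfies⁻ z = <-rec Satisfies⁻ satisfies⁻
    where
    Satisfies⁻ : ℕ → Set ℓ
    Satisfies⁻ n = valuation z ∈↑ φ n → R z n

    satisfies⁻ : ∀ n → (∀ {i} → i < n → Satisfies⁻ i) → Satisfies⁻ n
    satisfies⁻ n rec v∈ with Any.++⁻ (meets n n) v∈
    ... | inj₁ v∈meets =
      proj₂ (∈-filter⁻ (R? z) {xs = upTo (suc z)} (∣encode⇒∈ (proj₁ (∈↑-meets⁻ n n v∈meets))))
    ... | inj₂ v∈joins =
      let i , i<n , iRn , v∈φ = ∈↑-joins⁻ n n v∈joins in R-trans (rec i<n v∈φ) iRn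

  -- The inclusion is tested at the valuation of `m`. Reflexivity is asked for at `m` alone, since a
  -- transported order is not reflexive at numbers that index nothing.
  φ-reflects : ∀ {m n} → R m m → (∀ {v} → v ∈↑ φ m → v ∈↑ φ n) → R m n
  φ-reflects {m} {n} mRm ⊆ = valuation-satisfies⁻ m n (⊆ (valuation-satisfies m m ≤-refl mRm))

-- Universality and the coincidence of the orders.

Cycles-embeds : ∀ {c ℓ₁ ℓ₂} → ExcludedMiddle (c ⊔ ℓ₁ ⊔ ℓ₂) →
  (P : Poset c ℓ₁ ℓ₂) → Countable P → EmbedsInto P Cycles-LB
Cycles-embeds {c} {ℓ₁} {ℓ₂} em P countable = disjointCycles ∘ φ ∘ index , λ x y → mk⇔
  (λ x≤y → ⊆↑⇒≤ᴸᴮ (φ-mono (index x) (x , y , refl , refl , x≤y)))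
  (λ Ex≤Ey → reflects x y (φ-reflects (x , x , refl , refl , P.refl)
    (≤ᴸᴮ⇒⊆↑ {φ (index x)} {φ (index y)} Ex≤Ey)))
  where
  module P = Poset P
  open Injection countable using (injective) renaming (to to index)

  R : Rel ℕ (c ⊔ ℓ₂)
  R m n = ∃[ x ] ∃[ y ] index x ≡ m × index y ≡ n × x P.≤ y

  reflects : ∀ x y → R (index x) (index y) → x P.≤ y
  reflects x y (x′ , y′ , x′≡x , y′≡y , x′≤y′) =
    P.trans (P.reflexive (injective (sym x′≡x))) (P.trans x′≤y′ (P.reflexive (injective y′≡y)))

  R-trans : Transitive R
  R-trans (x , y , x≡i , y≡j , x≤y) (y′ , z , y′≡j , z≡k , y′≤z) =
    x , z , x≡i , z≡k , P.trans x≤y (P.trans (P.reflexive (injective (trans y≡j (sym y′≡j)))) y′≤z)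

  R? : Decidable R
  -- The lift raises `R m n` to the level at which excluded middle is assumed.
  R? m n = map′ lower lift (em {Lift ℓ₁ (R m n)})

  open Embedding R-trans R?

corollary5p7p7 : ∀ c ℓ₁ ℓ₂ →
    (Poset._≤_ Cycles-LB ⇔ Poset._≤_ Cycles-LS) ×
    (Poset._≤_ Cycles-LS ⇔ Poset._≤_ Cycles-LI) ×
    (ExcludedMiddle (c ⊔ ℓ₁ ⊔ ℓ₂) → Universal c ℓ₁ ℓ₂ Cycles-LB)
corollary5p7p7 c ℓ₁ ℓ₂ =
    ((λ {G H} → ≤ᴸᴮ⇒≤ᴸˢ {graph G} {graph H}) , λ {G H} → LS⇒LB G H)
  , ( (λ {G H} → ≤ᴸᴮ⇒≤ᴸᴵ {graph G} {graph H} ∘ LS⇒LB G H)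
    , λ {G H} → ≤ᴸᴮ⇒≤ᴸˢ {graph G} {graph H} ∘ lengths-≼⇒≤ᴸᴮ G H ∘ lengths-≤ᴸᴵ G H)
  , λ em → Cycles-countable (map′ lower lift (em {Lift (c ⊔ ℓ₁ ⊔ ℓ₂) _})) , Cycles-embeds em
  where
  -- The given homomorphism serves only to produce divisibilities; a new one is built from them by
  -- wrapping.
  LS⇒LB : ∀ G H → graph G ≤ᴸˢ graph H → graph G ≤ᴸᴮ graph H
  LS⇒LB G H = lengths-≼⇒≤ᴸᴮ G H ∘ lengths-≤ᴸˢ G H
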